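{- Suppose that $S$ is a nonempty admissible pinnacle set with $\max S=n$. Then $$p_S(n)=\sum_{\emptyset\neq A\subsetneq[n-1]} p_{\mathrm{std}_A(S)}(|A|)\cdot p_{\mathrm{std}_{A^c}(S)}(n-1-|A|),$$ where the sum is over all nonempty proper subsets $A$ of $[n-1]$ and $A^c=[n-1]\setminus A$.
   Context: Let $[n]=\{1,2,\ldots,n\}$ and let $S_n$ be the set of permutations of $[n]$, written as words $w=w(1)w(2)\cdots w(n)$. A pinnacle of $w\in S_n$ is a value $w(i)$ with $2\le i\le n-1$ and $w(i-1)<w(i)>w(i+1)$. The pinnacle set $\mathrm{Pin}(w)$ is the set of all pinnacles of $w$. A set $S$ is an admissible pinnacle set if $S=\mathrm{Pin}(w)$ for some $w\in S_k$ and some $k\ge1$. For a set $S$, $p_S(n)=|\{w\in S_n:\mathrm{Pin}(w)=S\}|$ (so $p_S(n)=0$ if no such $w$ exists). For a finite set of integers $X=\{x_1<x_2<\cdots<x_r\}$, the standardization of $S$ relative to $X$ is $\mathrm{std}_X(S)=\{i\in[r]: x_i\in S\}$. -}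

module Defs where

import Data.Nat.Properties as ℕ
open import Data.Bool.Base using (if_then_else_)
import Data.Vec.Base as Vec
open import Data.Fin.Base using (toℕ)
open import Data.Fin.Subset using (Subset; ⊤; inside; outside)
open import Data.Fin.Subset.Properties using (nonempty?; _⊂?_) renaming (_∈?_ to _∈ᶠ?_)
open import Data.List.Base using (List; []; _∷_; _++_; map; filter; length; lookup; applyUpTo; allFin; cartesianProductWith)
open import Data.List.Membership.DecPropositional ℕ._≟_ using (_∈?_)
open import Data.List.Membership.Propositional using (_∈_)
open import Data.List.Relation.Binary.BagAndSetEquality using (_∼[_]_; set)
open import Data.List.Relation.Binary.Subset.DecPropositional ℕ._≟_ using (_⊆?_)
open import Data.List.Relation.Unary.Unique.DecPropositional ℕ._≟_ using (unique?)
open import Data.Nat.Base using (ℕ; zero; suc; _≥_)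
open import Data.Product.Base using (_×_; _,_; ∃-syntax)
open import Function.Base using (_∘_)
open import Function.Bundles using (mk⇔; module Equivalence)
open import Relation.Binary.Definitions using (Decidable)
open import Relation.Nullary.Decidable using (does; map′; _×-dec_)

-- A finite set of naturals is given by a list: order and repetitions of its
-- entries are immaterial, and equality of sets is _≈ˢ_.

infix 4 _≈ˢ_ _≈ˢ?_

_≈ˢ_ : List ℕ → List ℕ → Set
S ≈ˢ T = S ∼[ set ] T

_≈ˢ?_ : Decidable _≈ˢ_
S ≈ˢ? T = map′
  (λ (S⊆T , T⊆S) {x} → mk⇔ (S⊆T {x}) (T⊆S {x}))
  (λ S≈T → (λ {x} → Equivalence.to (S≈T {x})) , (λ {x} → Equivalence.from (S≈T {x})))
  ((S ⊆? T) ×-dec (T ⊆? S))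

[1⋯_] : ℕ → List ℕ
[1⋯ n ] = applyUpTo suc n

words : List ℕ → ℕ → List (List ℕ)
words alphabet zero    = [] ∷ []
words alphabet (suc k) = cartesianProductWith _∷_ alphabet (words alphabet k)

-- Sₙ in one-line notation: the words of length n over [n] with distinct
-- letters.  Each permutation is listed exactly once.
permutations : ℕ → List (List ℕ)
permutations n = filter unique? (words [1⋯ n ] n)

-- The recursion visits every three consecutive letters, so the first and the
-- last letter of a word are never pinnacles.
Pin : List ℕ → List ℕ
Pin (a ∷ b ∷ c ∷ w) =
  if does ((a ℕ.<? b) ×-dec (c ℕ.<? b))
  then b ∷ Pin (b ∷ c ∷ w)
  else Pin (b ∷ c ∷ w)
Pin _ = []

Admissible : List ℕ → Set
Admissible S = ∃[ k ] k ≥ 1 × ∃[ w ] w ∈ permutations k × S ≈ˢ Pin w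

p : List ℕ → ℕ → ℕ
p S n = length (filter (λ w → Pin w ≈ˢ? S) (permutations n))

-- The set X must be given as the list x₁ < x₂ < ⋯ < xᵣ of its elements in
-- increasing order.  Positions in the list start at 0, hence the suc.
std : List ℕ → List ℕ → List ℕ
std X S = map (suc ∘ toℕ) (filter (λ i → lookup X i ∈? S) (allFin (length X)))

-- Subset m stands for the subsets of [m], with i : Fin m representing the
-- number 1 + i.  The elements are listed in increasing order, as std requires.
elements : ∀ {m} → Subset m → List ℕ
elements {m} A = map (suc ∘ toℕ) (filter (_∈ᶠ? A) (allFin m))

subsets : ∀ m → List (Subset m)
subsets zero    = Vec.[] ∷ []
subsets (suc m) = map (outside Vec.∷_) (subsets m) ++ map (inside Vec.∷_) (subsets m)

nonemptyProperSubsets : ∀ m → List (Subset m)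
nonemptyProperSubsets m = filter (λ A → nonempty? A ×-dec (A ⊂? ⊤)) (subsets m)

{-# OPTIONS --safe #-}
-- Removing the letter n from a permutation with pinnacle n leaves two nonempty
-- words.  If A is the set of letters of the left one, the letters of the right
-- one form Aᶜ, and neither cut destroys or creates a pinnacle other than n, so
-- the two words are arbitrary arrangements of A and Aᶜ with pinnacle sets A ∩ S
-- and Aᶜ ∩ S.  The increasing bijection [|A|] → A turns arrangements of A into
-- permutations with pinnacle set std_A(S).
module Submission where

open import Defs
import Data.Nat.Properties as ℕ
open import Data.Bool.Base using (true; false; if_then_else_)
open import Data.Bool.Properties using (if-float)
open import Data.Fin.Base using (Fin; zero; suc; toℕ; fromℕ<)
import Data.Fin.Base as Fin
open import Data.Fin.Properties using (toℕ<n; toℕ-fromℕ<; toℕ-injective)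
open import Data.Fin.Subset
  using (Subset; Nonempty; _⊂_; ⊤; inside; outside; ∁; ∣_∣) renaming (_∈_ to _∈ᶠ_)
open import Data.Fin.Subset.Properties
  using (nonempty?; _⊂?_; ∈⊤; ⊆⊤; ⊆-antisym; ∣∁p∣≡n∸∣p∣; x∈∁p⇒x∉p; x∉p⇒x∈∁p)
  renaming (_∈?_ to _∈ᶠ?_)
open import Data.List.Base
  using (List; []; _∷_; _++_; map; filter; length; lookup; allFin; tabulate; concatMap;
    cartesianProduct; cartesianProductWith)
open import Data.List.Extrema.Nat using (max; xs≤max; argmax-sel)
open import Data.List.Membership.DecPropositional ℕ._≟_ using (_∈?_)
open import Data.List.Membership.Propositional using (_∈_; _∉_; find; lose)
open import Data.List.Membership.Propositional.Properties
open import Data.List.Properties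
  using (length-map; length-applyUpTo; length-++; length-++-sucʳ; ∷-injective; map-cong)
open import Data.List.Relation.Binary.Subset.Propositional using (_⊆_)
open import Data.List.Relation.Unary.All as All using (All; []; _∷_)
import Data.List.Relation.Unary.All.Properties as All
open import Data.List.Relation.Unary.AllPairs as AllPairs using (AllPairs; []; _∷_)
import Data.List.Relation.Unary.AllPairs.Properties as AllPairs
open import Data.List.Relation.Unary.Any using (here; there; index)
open import Data.List.Relation.Unary.Any.Properties using (lookup-index)
open import Data.List.Relation.Unary.Unique.DecPropositional ℕ._≟_ using (unique?)
open import Data.List.Relation.Unary.Unique.Propositional using (Unique)
import Data.List.Relation.Unary.Unique.Propositional.Properties as Unique
open import Data.Nat.Base using (ℕ; zero; suc; _+_; _*_; _∸_; _≤_; _<_; z≤n; s≤s; s≤s⁻¹)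
open import Data.Nat.ListAction using (sum)
open import Data.Nat.Properties
  using (≤-trans; ≤-reflexive; ≤-antisym; ≤-refl; <⇒≢; <-asym; <-irrefl; <-cmp; ≤∧≢⇒<; _<?_;
    suc-injective; m≤n⇒m≤1+n)
open import Data.Product.Base using (∃; ∃₂; _×_; _,_; proj₁; proj₂)
open import Data.Sum.Base using (_⊎_; inj₁; inj₂; [_,_]′)
open import Data.Vec.Base using ([]; _∷_)
import Data.Vec.Base as Vec
import Data.Vec.Properties as Vec
open import Function.Base using (_∘_; id)
open import Function.Bundles using (_⇔_; mk⇔; module Equivalence)
open import Relation.Binary.Definitions using (tri<; tri≈; tri>)
open import Relation.Binary.PropositionalEquality.Core
  using (_≡_; _≢_; refl; sym; trans; cong; cong₂; subst)
open import Relation.Binary.PropositionalEquality.Properties using (module ≡-Reasoning)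
open import Relation.Nullary using (¬_; Dec; yes; no; does; contradiction; _×-dec_)
open import Relation.Nullary.Decidable using (does-⇔; dec-true; dec-false)

open Equivalence using (to; from)

private
  variable
    I A B C : Set
    X Y S a b w : List ℕ
    m n x y : ℕ

-- Counting with duplicate-free lists.

unique-⊆⇒length≤ : {xs ys : List A} → Unique xs → xs ⊆ ys → length xs ≤ length ys
unique-⊆⇒length≤ [] _ = z≤n
unique-⊆⇒length≤ {xs = x ∷ xs} (x∉xs ∷ xs!) xs⊆ys
  -- One occurrence of `x` is cut out of `ys`. The tail `xs` does not contain `x`, so it still lies
  -- in what is left.
  with l , r , refl ← ∈-∃++ (xs⊆ys (here refl)) =
  ≤-trans (s≤s (unique-⊆⇒length≤ xs! xs⊆l++r)) (≤-reflexive (sym (length-++-sucʳ l x r)))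
  where
  xs⊆l++r : xs ⊆ l ++ r
  xs⊆l++r y∈xs with ∈-++⁻ l (xs⊆ys (there y∈xs))
  ... | inj₁ y∈l         = ∈-++⁺ˡ y∈l
  ... | inj₂ (here refl) = contradiction refl (All.lookup x∉xs y∈xs)
  ... | inj₂ (there y∈r) = ∈-++⁺ʳ l y∈r

unique-set⇒length≡ : {xs ys : List A} → Unique xs → Unique ys → xs ⊆ ys → ys ⊆ xs →
                      length xs ≡ length ys
unique-set⇒length≡ xs! ys! xs⊆ys ys⊆xs =
  ≤-antisym (unique-⊆⇒length≤ xs! xs⊆ys) (unique-⊆⇒length≤ ys! ys⊆xs)

-- Pigeonhole: an element `y` of `Y` missing from `X` could be put in front of `X`, giving a
-- duplicate-free list inside `Y` that is longer than `Y`.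
unique-⊆∧length≡⇒⊇ : Unique X → X ⊆ Y → length X ≡ length Y → Y ⊆ X
unique-⊆∧length≡⇒⊇ {X} {Y} X! X⊆Y eq {y} y∈Y with y ∈? X
... | yes y∈X = y∈X
... | no  y∉X = contradiction eq (<⇒≢ (unique-⊆⇒length≤ (All.¬Any⇒All¬ X y∉X ∷ X!) y∷X⊆Y))
  where
  y∷X⊆Y : y ∷ X ⊆ Y
  y∷X⊆Y (here refl) = y∈Y
  y∷X⊆Y (there z∈X) = X⊆Y z∈X

-- Injectivity is asked for on the entries alone, because the relabelling `nth X` below is injective
-- on the positions of an increasing `X` but not on all of `ℕ`.
unique-map-local : {f : A → B} {xs : List A} →
                   (∀ {x y} → x ∈ xs → y ∈ xs → f x ≡ f y → x ≡ y) →
                   Unique xs → Unique (map f xs)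
unique-map-local inj [] = []
unique-map-local inj (x∉xs ∷ xs!) =
  All.map⁺ (All.tabulate λ y∈xs eq → All.lookup x∉xs y∈xs (inj (here refl) (there y∈xs) eq))
  ∷ unique-map-local (λ p q → inj (there p) (there q)) xs!

map-injective-local : {f : A → B} {xs ys : List A} →
                      (∀ {x y} → x ∈ xs → y ∈ ys → f x ≡ f y → x ≡ y) →
                      map f xs ≡ map f ys → xs ≡ ys
map-injective-local {xs = []}     {[]}     inj eq = refl
map-injective-local {xs = x ∷ xs} {y ∷ ys} inj eq with eq₁ , eq₂ ← ∷-injective eq =
  cong₂ _∷_ (inj (here refl) (here refl) eq₁)
            (map-injective-local (λ p q → inj (there p) (there q)) eq₂)

unique-concatMap : {f : A → List B} {xs : List A} →
                   Unique xs → (∀ {x} → x ∈ xs → Unique (f x)) →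
                   (∀ {x y z} → z ∈ f x → z ∈ f y → x ≡ y) →
                   Unique (concatMap f xs)
unique-concatMap {xs = xs} xs! f! f-disjoint = Unique.concat⁺
  (All.map⁺ (All.tabulate f!))
  (AllPairs.map⁺ (AllPairs.map (λ x≢y {_} (p , q) → x≢y (f-disjoint p q)) xs!))

length-cartesianProductWith : (f : A → B → C) (xs : List A) (ys : List B) →
                              length (cartesianProductWith f xs ys) ≡ length xs * length ys
length-cartesianProductWith f []       ys = refl
length-cartesianProductWith f (x ∷ xs) ys = trans
  (length-++ (map (f x) ys))
  (cong₂ _+_ (length-map (f x) ys) (length-cartesianProductWith f xs ys))

length-concatMap : (f : A → List B) (xs : List A) →
                   length (concatMap f xs) ≡ sum (map (length ∘ f) xs)
length-concatMap f []       = refl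
length-concatMap f (x ∷ xs) =
  trans (length-++ (f x)) (cong (length (f x) +_) (length-concatMap f xs))

-- As `x` is in neither prefix, its first occurrence in the common word marks the end of both. This
-- makes the cut at the largest letter recoverable.
++-∷-injective : {x : A} (as : List A) {bs cs ds : List A} → x ∉ as → x ∉ cs →
                 as ++ x ∷ bs ≡ cs ++ x ∷ ds → as ≡ cs × bs ≡ ds
++-∷-injective []       {cs = []}     _    _    refl = refl , refl
++-∷-injective []       {cs = c ∷ cs} _    x∉cs eq with refl , _ ← ∷-injective eq =
  contradiction (here refl) x∉cs
++-∷-injective (a ∷ as) {cs = []}     x∉as _    eq with refl , _ ← ∷-injective eq =
  contradiction (here refl) x∉as
++-∷-injective (a ∷ as) {cs = c ∷ cs} x∉as x∉cs eq
  with refl , eq′ ← ∷-injective eq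
  with refl , bs≡ds ← ++-∷-injective as (x∉as ∘ there) (x∉cs ∘ there) eq′ = refl , bs≡ds

-- The interval [n], words and permutations.

∈-[1⋯]⁺ : 1 ≤ x → x ≤ n → x ∈ [1⋯ n ]
∈-[1⋯]⁺ {suc x} _ x≤n = ∈-applyUpTo⁺ suc x≤n

∈-[1⋯]⁻ : x ∈ [1⋯ n ] → 1 ≤ x × x ≤ n
∈-[1⋯]⁻ x∈ with _ , i<n , refl ← ∈-applyUpTo⁻ suc x∈ = s≤s z≤n , i<n

∈-[1⋯]⇒Fin : x ∈ [1⋯ n ] → ∃ λ (i : Fin n) → x ≡ suc (toℕ i)
∈-[1⋯]⇒Fin x∈ with _ , i<n , refl ← ∈-applyUpTo⁻ suc x∈ =
  fromℕ< i<n , cong suc (sym (toℕ-fromℕ< i<n))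

Fin⇒∈-[1⋯] : (i : Fin n) → suc (toℕ i) ∈ [1⋯ n ]
Fin⇒∈-[1⋯] i = ∈-applyUpTo⁺ suc (toℕ<n i)

[1⋯]-unique : ∀ n → Unique [1⋯ n ]
[1⋯]-unique n = Unique.applyUpTo⁺₁ suc n (λ i<j _ → <⇒≢ (s≤s i<j))

length-[1⋯] : ∀ n → length [1⋯ n ] ≡ n
length-[1⋯] n = length-applyUpTo suc n

∈-words⁺ : {w : List ℕ} → w ⊆ X → w ∈ words X (length w)
∈-words⁺ {w = []}    _   = here refl
∈-words⁺ {w = x ∷ w} w⊆X = ∈-cartesianProductWith⁺ _∷_ (w⊆X (here refl)) (∈-words⁺ (w⊆X ∘ there))

∈-words⁻ : ∀ k → w ∈ words X k → length w ≡ k × w ⊆ X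
∈-words⁻ zero (here refl) = refl , λ ()
∈-words⁻ {X = X} (suc k) w∈
  with x , v , x∈ , v∈ , refl ← ∈-cartesianProductWith⁻ _∷_ X (words X k) w∈
  with eq , v⊆X ← ∈-words⁻ k v∈ = cong suc eq , λ where
    (here refl) → x∈
    (there y∈v) → v⊆X y∈v

words-unique : ∀ k → Unique X → Unique (words X k)
words-unique zero    X! = [] ∷ []
words-unique (suc k) X! = Unique.cartesianProductWith⁺ _∷_ ∷-injective X! (words-unique k X!)

permutations-unique : ∀ n → Unique (permutations n)
permutations-unique n = Unique.filter⁺ unique? (words-unique n ([1⋯]-unique n))

-- The length that `words` prescribes comes for free: distinct letters that exhaust `[1⋯ n ]` are
-- `n` in number.
∈-permutations⁺ : Unique w → w ≈ˢ [1⋯ n ] → w ∈ permutations n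
∈-permutations⁺ {w} {n} w! w≈ =
  ∈-filter⁺ unique? (subst (λ k → w ∈ words [1⋯ n ] k) eq (∈-words⁺ (to w≈))) w!
  where
  eq : length w ≡ n
  eq = trans (unique-set⇒length≡ w! ([1⋯]-unique n) (to w≈) (from w≈)) (length-[1⋯] n)

∈-permutations⁻ : w ∈ permutations n → Unique w × w ≈ˢ [1⋯ n ]
∈-permutations⁻ {w} {n} w∈
  with w∈words , w! ← ∈-filter⁻ unique? {xs = words [1⋯ n ] n} w∈
  with eq , w⊆ ← ∈-words⁻ n w∈words =
  -- Conversely, `n` distinct letters taken from `[1⋯ n ]` leave none out.
  w! , mk⇔ w⊆ (unique-⊆∧length≡⇒⊇ w! w⊆ (trans eq (sym (length-[1⋯] n))))

-- Pinnacles of a word.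

∈-Pin-∷⁻ : ∀ w → x ∈ Pin (m ∷ y ∷ n ∷ w) → x ≡ y ⊎ x ∈ Pin (y ∷ n ∷ w)
∈-Pin-∷⁻ {m = m} {y} {n} w x∈ with does ((m <? y) ×-dec (n <? y)) | x∈
... | false | x∈′       = inj₂ x∈′
... | true  | here x≡y  = inj₁ x≡y
... | true  | there x∈′ = inj₂ x∈′

Pin-⊆ : ∀ w → Pin w ⊆ w
Pin-⊆ (a ∷ b ∷ c ∷ w) x∈ =
  [ (λ { refl → there (here refl) }) , there ∘ Pin-⊆ (b ∷ c ∷ w) ]′ (∈-Pin-∷⁻ w x∈)

-- Being a pinnacle depends only on comparisons between neighbours. The map has to reflect order as
-- well as preserve it, so that both outcomes of each test carry over.
Pin-map : ∀ (f : ℕ → ℕ) w → (∀ {x y} → x ∈ w → y ∈ w → (x < y) ⇔ (f x < f y)) →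
          Pin (map f w) ≡ map f (Pin w)
Pin-map f [] _ = refl
Pin-map f (a ∷ []) _ = refl
Pin-map f (a ∷ b ∷ []) _ = refl
Pin-map f (a ∷ b ∷ c ∷ w) f-mono = begin
  (if does D′ then f b ∷ Pin (map f (b ∷ c ∷ w)) else Pin (map f (b ∷ c ∷ w)))
    ≡⟨ cong (λ P → if does D′ then f b ∷ P else P) (Pin-map f (b ∷ c ∷ w) (λ p q → f-mono (there p) (there q))) ⟩
  (if does D′ then f b ∷ P else P)
    ≡⟨ cong (λ t → if t then f b ∷ P else P) (sym (does-⇔ D⇔D′ D D′)) ⟩
  (if does D then f b ∷ P else P)
    ≡⟨ if-float (map f) (does D) ⟨
  map f (Pin (a ∷ b ∷ c ∷ w)) ∎
  where
  open ≡-Reasoning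
  P = map f (Pin (b ∷ c ∷ w))
  D = (a <? b) ×-dec (c <? b)
  D′ = (f a <? f b) ×-dec (f c <? f b)
  a<b = f-mono {a} {b} (here refl) (there (here refl))
  c<b = f-mono {c} {b} (there (there (here refl))) (there (here refl))
  D⇔D′ : (a < b × c < b) ⇔ (f a < f b × f c < f b)
  D⇔D′ = mk⇔ (λ (p , q) → to a<b p , to c<b q) (λ (p , q) → from a<b p , from c<b q)

-- A letter below its left neighbour is no pinnacle, and neither is a first letter, so dropping that
-- neighbour changes nothing.
Pin-descent : ∀ w → y < x → Pin (x ∷ y ∷ w) ≡ Pin (y ∷ w)
Pin-descent [] _ = refl
Pin-descent {y} {x} (z ∷ w) y<x
  rewrite dec-false ((x <? y) ×-dec (z <? y)) (λ (x<y , _) → <-asym x<y y<x) = refl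

Pin-peak : ∀ w → x < y → n < y → Pin (x ∷ y ∷ n ∷ w) ≡ y ∷ Pin (n ∷ w)
Pin-peak {x} {y} {n} w x<y n<y
  rewrite dec-true ((x <? y) ×-dec (n <? y)) (x<y , n<y) = cong (y ∷_) (Pin-descent w n<y)

-- The last letter on the left is followed by the larger `n` and the first letter on the right is
-- preceded by it. Neither is a pinnacle, just as at the ends of the separate words. Both words are
-- displayed with a first letter because `n` needs a neighbour on each side.
Pin-++-∷-++ : ∀ a b {x y} → All (_< n) (x ∷ a) → All (_< n) (y ∷ b) →
              Pin ((x ∷ a) ++ n ∷ y ∷ b) ≡ Pin (x ∷ a) ++ n ∷ Pin (y ∷ b)
Pin-++-∷-++ [] b (x<n ∷ []) (y<n ∷ _) = Pin-peak b x<n y<n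
Pin-++-∷-++ {n} (z ∷ []) b {x} {y} (x<n ∷ z<n ∷ []) (y<n ∷ _)
  rewrite dec-false ((x <? z) ×-dec (n <? z)) (λ (_ , n<z) → <-asym n<z z<n) = Pin-peak b z<n y<n
Pin-++-∷-++ {n} (z ∷ z′ ∷ a) b {x} {y} (x<n ∷ a<n) b<n
  with does ((x <? z) ×-dec (z′ <? z))
... | true  = cong (z ∷_) (Pin-++-∷-++ (z′ ∷ a) b a<n b<n)
... | false = Pin-++-∷-++ (z′ ∷ a) b a<n b<n

Interior : ℕ → List ℕ → Set
Interior x w = ∃₂ λ y a → ∃₂ λ z b → w ≡ (y ∷ a) ++ x ∷ z ∷ b

∈-Pin⇒interior : ∀ w → x ∈ Pin w → Interior x w
∈-Pin⇒interior {x} (y ∷ y′ ∷ z ∷ w) x∈ =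
  [ (λ { refl → y , [] , z , w , refl }) , extend ∘ ∈-Pin⇒interior (y′ ∷ z ∷ w) ]′ (∈-Pin-∷⁻ w x∈)
  where
  extend : Interior x (y′ ∷ z ∷ w) → Interior x (y ∷ y′ ∷ z ∷ w)
  extend (v , a , z , b , eq) = y , v ∷ a , z , b , cong (y ∷_) eq

-- Increasing lists as order-preserving labellings, and standardization.

Increasing : List ℕ → Set
Increasing = AllPairs _<_

lookup-< : {X : List ℕ} → Increasing X → {i j : Fin (length X)} → i Fin.< j → lookup X i < lookup X j
lookup-< (x<X ∷ _)  {zero}  {suc j} _         = All.lookup x<X (∈-lookup j)
lookup-< (_   ∷ X↗) {suc i} {suc j} (s≤s i<j) = lookup-< X↗ i<j

-- Positions start at 1; the values at 0 and beyond the length of X are junk.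
nth : List ℕ → ℕ → ℕ
nth []      _             = 0
nth (x ∷ X) (suc (suc i)) = nth X (suc i)
nth (x ∷ X) _             = x

nth-lookup : ∀ X (i : Fin (length X)) → nth X (suc (toℕ i)) ≡ lookup X i
nth-lookup (x ∷ X) zero    = refl
nth-lookup (x ∷ X) (suc i) = nth-lookup X i

nth-∈ : x ∈ [1⋯ length X ] → nth X x ∈ X
nth-∈ {X = X} x∈ with i , refl ← ∈-[1⋯]⇒Fin x∈ =
  subst (_∈ X) (sym (nth-lookup X i)) (∈-lookup i)

∈⇒nth : x ∈ X → ∃ λ i → i ∈ [1⋯ length X ] × x ≡ nth X i
∈⇒nth {X = X} x∈X = suc (toℕ i) , Fin⇒∈-[1⋯] i , trans (lookup-index x∈X) (sym (nth-lookup X i))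
  where i = index x∈X

nth-mono : Increasing X → x ∈ [1⋯ length X ] → y ∈ [1⋯ length X ] → x < y → nth X x < nth X y
nth-mono {X} X↗ x∈ y∈ x<y
  with i , refl ← ∈-[1⋯]⇒Fin x∈ | j , refl ← ∈-[1⋯]⇒Fin y∈
  rewrite nth-lookup X i | nth-lookup X j = lookup-< X↗ (s≤s⁻¹ x<y)

nth-mono⇔ : Increasing X → x ∈ [1⋯ length X ] → y ∈ [1⋯ length X ] → (x < y) ⇔ (nth X x < nth X y)
nth-mono⇔ {X} {x} {y} X↗ x∈ y∈ = mk⇔ (nth-mono X↗ x∈ y∈) reflects
  where
  reflects : nth X x < nth X y → x < y
  reflects lt with <-cmp x y
  ... | tri< x<y _ _  = x<y
  ... | tri≈ _ refl _ = contradiction lt (<-irrefl refl)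
  ... | tri> _ _ y<x  = contradiction lt (<-asym (nth-mono X↗ y∈ x∈ y<x))

nth-injective : Increasing X → x ∈ [1⋯ length X ] → y ∈ [1⋯ length X ] → nth X x ≡ nth X y → x ≡ y
nth-injective {X} {x} {y} X↗ x∈ y∈ eq with <-cmp x y
... | tri< x<y _ _ = contradiction eq (<⇒≢ (nth-mono X↗ x∈ y∈ x<y))
... | tri≈ _ x≡y _ = x≡y
... | tri> _ _ y<x = contradiction (sym eq) (<⇒≢ (nth-mono X↗ y∈ x∈ y<x))

-- Trades the zero-based indices in the definition of `std` for the one-based positions on which
-- `nth` acts. All later reasoning about `std` goes through this characterization.
∈-std : ∀ X → x ∈ std X S ⇔ (x ∈ [1⋯ length X ] × nth X x ∈ S)
∈-std {S = S} X = mk⇔ ⇒ ⇐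
  where
  lookup∈S? = λ i → lookup X i ∈? S
  ⇒ : x ∈ std X S → x ∈ [1⋯ length X ] × nth X x ∈ S
  ⇒ x∈ with i , i∈ , refl ← ∈-map⁻ (suc ∘ toℕ) x∈ =
    Fin⇒∈-[1⋯] i ,
    subst (_∈ S) (sym (nth-lookup X i)) (proj₂ (∈-filter⁻ lookup∈S? {xs = allFin _} i∈))
  ⇐ : x ∈ [1⋯ length X ] × nth X x ∈ S → x ∈ std X S
  ⇐ (x∈ , ∈S) with i , refl ← ∈-[1⋯]⇒Fin x∈ =
    ∈-map⁺ (suc ∘ toℕ) (∈-filter⁺ lookup∈S? (∈-allFin i) (subst (_∈ S) (nth-lookup X i) ∈S))

-- Arrangements of a letter set with prescribed pinnacles.

-- The pinnacle set is the intersection of `X` and `S` rather than `S` itself, so that the same `S`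
-- serves the whole word and both of its pieces.
record Arrangement (X S w : List ℕ) : Set where
  field
    unique    : Unique w
    letters   : w ≈ˢ X
    pinnacles : ∀ {x} → x ∈ Pin w ⇔ (x ∈ X × x ∈ S)

open Arrangement

permutationsWithPin : List ℕ → ℕ → List (List ℕ)
permutationsWithPin S n = filter (λ w → Pin w ≈ˢ? S) (permutations n)

permutationsWithPin-unique : ∀ S n → Unique (permutationsWithPin S n)
permutationsWithPin-unique S n = Unique.filter⁺ (λ w → Pin w ≈ˢ? S) (permutations-unique n)

∈-permutationsWithPin⁻ : w ∈ permutationsWithPin S n → (Unique w × w ≈ˢ [1⋯ n ]) × Pin w ≈ˢ S
∈-permutationsWithPin⁻ {S = S} {n} w∈
  with w∈perms , Pin≈S ← ∈-filter⁻ (λ w → Pin w ≈ˢ? S) {xs = permutations n} w∈ =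
  ∈-permutations⁻ w∈perms , Pin≈S

-- Under `S ⊆ [1⋯ n ]`, intersecting `S` with the set of letters leaves it unchanged.
∈-permutationsWithPin⇔Arrangement : S ⊆ [1⋯ n ] → w ∈ permutationsWithPin S n ⇔ Arrangement [1⋯ n ] S w
∈-permutationsWithPin⇔Arrangement {S} {n} {w} S⊆ = mk⇔ ⇒ ⇐
  where
  ⇒ : w ∈ permutationsWithPin S n → Arrangement [1⋯ n ] S w
  ⇒ w∈ with (w! , w≈) , Pin≈S ← ∈-permutationsWithPin⁻ w∈ = record
    { unique    = w!
    ; letters   = w≈
    ; pinnacles = mk⇔ (λ x∈ → S⊆ (to Pin≈S x∈) , to Pin≈S x∈) (λ (_ , x∈S) → from Pin≈S x∈S)
    }
  ⇐ : Arrangement [1⋯ n ] S w → w ∈ permutationsWithPin S n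
  ⇐ arr = ∈-filter⁺ (λ w → Pin w ≈ˢ? S) (∈-permutations⁺ (unique arr) (letters arr))
    (mk⇔ (proj₂ ∘ to (pinnacles arr)) (λ x∈S → from (pinnacles arr) (S⊆ x∈S , x∈S)))

-- For increasing `X` these are exactly the words satisfying `Arrangement X S`. Obtaining them by
-- relabelling permutations makes their number a value of `p` by construction.
arrangements : List ℕ → List ℕ → List (List ℕ)
arrangements X S = map (map (nth X)) (permutationsWithPin (std X S) (length X))

length-arrangements : ∀ X S → length (arrangements X S) ≡ p (std X S) (length X)
length-arrangements X S = length-map (map (nth X)) (permutationsWithPin (std X S) (length X))

arrangements-unique : Increasing X → Unique (arrangements X S)
arrangements-unique {X} {S} X↗ = unique-map-local inj (permutationsWithPin-unique (std X S) (length X))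
  where
  inj : ∀ {u v} → u ∈ permutationsWithPin (std X S) (length X) → v ∈ permutationsWithPin (std X S) (length X) →
        map (nth X) u ≡ map (nth X) v → u ≡ v
  inj u∈ v∈ with (_ , u≈) , _ ← ∈-permutationsWithPin⁻ u∈ | (_ , v≈) , _ ← ∈-permutationsWithPin⁻ v∈ =
    map-injective-local (λ x∈u y∈v → nth-injective X↗ (to u≈ x∈u) (to v≈ y∈v))

-- `nth X` preserves and reflects order on positions, so pinnacles are relabelled along with the
-- letters, and `∈-std` turns the set `std X S` of positions into the part of `S` inside `X`.
∈-arrangements⁻ : Increasing X → w ∈ arrangements X S → Arrangement X S w
∈-arrangements⁻ {X} {S = S} X↗ w∈
  with u , u∈ , refl ← ∈-map⁻ (map (nth X)) w∈
  with (u! , u≈) , Pin≈ ← ∈-permutationsWithPin⁻ {S = std X S} u∈ = record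
  { unique    = unique-map-local (λ p q → nth-injective X↗ (to u≈ p) (to u≈ q)) u!
  ; letters   = mk⇔ letters⇒ letters⇐
  ; pinnacles = mk⇔ pinnacles⇒ pinnacles⇐
  }
  where
  Pin≡ : Pin (map (nth X) u) ≡ map (nth X) (Pin u)
  Pin≡ = Pin-map (nth X) u (λ p q → nth-mono⇔ X↗ (to u≈ p) (to u≈ q))
  letters⇒ : map (nth X) u ⊆ X
  letters⇒ x∈ with i , i∈ , refl ← ∈-map⁻ (nth X) x∈ = nth-∈ (to u≈ i∈)
  letters⇐ : X ⊆ map (nth X) u
  letters⇐ x∈ with i , i∈ , refl ← ∈⇒nth x∈ = ∈-map⁺ (nth X) (from u≈ i∈)
  pinnacles⇒ : ∀ {x} → x ∈ Pin (map (nth X) u) → x ∈ X × x ∈ S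
  pinnacles⇒ x∈ with i , i∈ , refl ← ∈-map⁻ (nth X) (subst (_ ∈_) Pin≡ x∈)
    with i∈[] , ∈S ← to (∈-std X) (to Pin≈ i∈) = nth-∈ i∈[] , ∈S
  pinnacles⇐ : ∀ {x} → x ∈ X × x ∈ S → x ∈ Pin (map (nth X) u)
  pinnacles⇐ (x∈X , x∈S) with i , i∈ , refl ← ∈⇒nth x∈X =
    subst (_ ∈_) (sym Pin≡) (∈-map⁺ (nth X) (from Pin≈ (from (∈-std X) (i∈ , x∈S))))

map-nth-surjective : w ⊆ X → ∃ λ u → u ⊆ [1⋯ length X ] × w ≡ map (nth X) u
map-nth-surjective {w = []}    _   = [] , (λ ()) , refl
map-nth-surjective {w = x ∷ w} w⊆X
  with i , i∈ , refl ← ∈⇒nth (w⊆X (here refl))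
  with u , u⊆ , refl ← map-nth-surjective (w⊆X ∘ there) =
  i ∷ u , (λ { (here refl) → i∈ ; (there j∈u) → u⊆ j∈u }) , refl

∈-arrangements⁺ : Increasing X → Arrangement X S w → w ∈ arrangements X S
∈-arrangements⁺ {X} {S} X↗ arr
  with u , u⊆ , refl ← map-nth-surjective (to (letters arr)) =
  ∈-map⁺ (map (nth X)) (∈-filter⁺ (λ w → Pin w ≈ˢ? std X S)
    (∈-permutations⁺ (Unique.map⁻ (unique arr)) (mk⇔ u⊆ u⊇))
    (mk⇔ Pin⇒ Pin⇐))
  where
  Pin≡ : Pin (map (nth X) u) ≡ map (nth X) (Pin u)
  Pin≡ = Pin-map (nth X) u (λ p q → nth-mono⇔ X↗ (u⊆ p) (u⊆ q))
  u⊇ : [1⋯ length X ] ⊆ u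
  -- The label of `i` occurs in the word, so some `j` in `u` carries the same label; injectivity on
  -- positions identifies `j` with `i`. `Pin⇐` argues in the same way.
  u⊇ i∈ with j , j∈u , eq ← ∈-map⁻ (nth X) (from (letters arr) (nth-∈ i∈)) =
    subst (_∈ u) (sym (nth-injective X↗ i∈ (u⊆ j∈u) eq)) j∈u
  Pin⇒ : Pin u ⊆ std X S
  Pin⇒ i∈ = from (∈-std X) (u⊆ (Pin-⊆ u i∈) ,
    proj₂ (to (pinnacles arr) (subst (_ ∈_) (sym Pin≡) (∈-map⁺ (nth X) i∈))))
  Pin⇐ : std X S ⊆ Pin u
  Pin⇐ i∈ with i∈[] , ∈S ← to (∈-std X) i∈
    with j , j∈ , eq ← ∈-map⁻ (nth X) (subst (_ ∈_) Pin≡ (from (pinnacles arr) (nth-∈ i∈[] , ∈S))) =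
    subst (_∈ Pin u) (sym (nth-injective X↗ i∈[] (u⊆ (Pin-⊆ u j∈)) eq)) j∈

-- Subsets of [m] and their lists of elements.

elements-increasing : (A : Subset m) → Increasing (elements A)
elements-increasing A =
  AllPairs.map⁺ (AllPairs.map s≤s (AllPairs.filter⁺ (_∈ᶠ? A) (AllPairs.tabulate⁺-< id)))

∈-elements⁺ : {A : Subset m} {i : Fin m} → i ∈ᶠ A → suc (toℕ i) ∈ elements A
∈-elements⁺ {A = A} {i} i∈A = ∈-map⁺ (suc ∘ toℕ) (∈-filter⁺ (_∈ᶠ? A) (∈-allFin i) i∈A)

∈-elements⁻ : {A : Subset m} → x ∈ elements A → ∃ λ i → i ∈ᶠ A × x ≡ suc (toℕ i)
∈-elements⁻ {A = A} x∈ with i , i∈ , refl ← ∈-map⁻ (suc ∘ toℕ) x∈ =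
  i , proj₂ (∈-filter⁻ (_∈ᶠ? A) {xs = allFin _} i∈) , refl

suc-toℕ-∈-elements⁻ : {A : Subset m} {i : Fin m} → suc (toℕ i) ∈ elements A → i ∈ᶠ A
suc-toℕ-∈-elements⁻ {A = A} x∈ with _ , j∈ , eq ← ∈-elements⁻ {A = A} x∈ =
  subst (_∈ᶠ A) (sym (toℕ-injective (suc-injective eq))) j∈

elements-⊆-[1⋯] : (A : Subset m) → elements A ⊆ [1⋯ m ]
elements-⊆-[1⋯] A x∈ with i , _ , refl ← ∈-elements⁻ {A = A} x∈ = Fin⇒∈-[1⋯] i

elements-disjoint : (A : Subset m) → x ∈ elements A → x ∉ elements (∁ A)
elements-disjoint A x∈ x∈∁ with i , i∈ , refl ← ∈-elements⁻ {A = A} x∈ =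
  x∈∁p⇒x∉p (suc-toℕ-∈-elements⁻ x∈∁) i∈

elements-cover : (A : Subset m) → x ∈ [1⋯ m ] → x ∈ elements A ⊎ x ∈ elements (∁ A)
elements-cover A x∈ with i , refl ← ∈-[1⋯]⇒Fin x∈ with i ∈ᶠ? A
... | yes i∈A = inj₁ (∈-elements⁺ i∈A)
... | no  i∉A = inj₂ (∈-elements⁺ (x∉p⇒x∈∁p i∉A))

elements-injective : {A B : Subset m} → elements A ≈ˢ elements B → A ≡ B
elements-injective eq = ⊆-antisym
  (suc-toℕ-∈-elements⁻ ∘ to eq ∘ ∈-elements⁺)
  (suc-toℕ-∈-elements⁻ ∘ from eq ∘ ∈-elements⁺)

does-∈? : (i : Fin m) (A : Subset m) → does (i ∈ᶠ? A) ≡ Vec.lookup A i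
does-∈? zero    (outside ∷ A) = refl
does-∈? zero    (inside  ∷ A) = refl
does-∈? (suc i) (_       ∷ A) = does-∈? i A

-- Stated for an arbitrary enumeration `f`, since the induction replaces `f` by `f ∘ suc`. Agreement
-- is required of booleans, as `∣ A ∣` counts the entries `inside` of the vector `A`.
length-filter-tabulate : {P : I → Set} (P? : ∀ x → Dec (P x)) (f : Fin m → I) (A : Subset m) →
                         (∀ i → does (P? (f i)) ≡ Vec.lookup A i) →
                         length (filter P? (tabulate f)) ≡ ∣ A ∣
length-filter-tabulate P? f []      eq = refl
length-filter-tabulate P? f (s ∷ A) eq with does (P? (f zero)) | eq zero
... | true  | refl = cong suc (length-filter-tabulate P? (f ∘ suc) A (eq ∘ suc))
... | false | refl = length-filter-tabulate P? (f ∘ suc) A (eq ∘ suc)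

length-elements : (A : Subset m) → length (elements A) ≡ ∣ A ∣
length-elements A = trans (length-map (suc ∘ toℕ) (filter (_∈ᶠ? A) (allFin _)))
                          (length-filter-tabulate (_∈ᶠ? A) id A (λ i → does-∈? i A))

-- Recovers the index `A` of the sum from the word to the left of the largest letter.
subsetOf : ∀ m → List ℕ → Subset m
subsetOf m X = Vec.tabulate (λ i → does (suc (toℕ i) ∈? X))

does-true⇒ : {P : Set} (P? : Dec P) → does P? ≡ true → P
does-true⇒ (yes p) _ = p

∈-subsetOf⁺ : {i : Fin m} → suc (toℕ i) ∈ X → i ∈ᶠ subsetOf m X
∈-subsetOf⁺ {X = X} {i} x∈ = Vec.lookup⇒[]= i _
  (trans (Vec.lookup∘tabulate _ i) (dec-true (suc (toℕ i) ∈? X) x∈))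

∈-subsetOf⁻ : {i : Fin m} → i ∈ᶠ subsetOf m X → suc (toℕ i) ∈ X
∈-subsetOf⁻ {X = X} {i} i∈ = does-true⇒ (suc (toℕ i) ∈? X)
  (trans (sym (Vec.lookup∘tabulate _ i)) (Vec.[]=⇒lookup i∈))

∈-subsets : (A : Subset m) → A ∈ subsets m
∈-subsets []            = here refl
∈-subsets (outside ∷ A) = ∈-++⁺ˡ (∈-map⁺ (outside ∷_) (∈-subsets A))
∈-subsets (inside  ∷ A) = ∈-++⁺ʳ _ (∈-map⁺ (inside ∷_) (∈-subsets A))

subsets-unique : ∀ m → Unique (subsets m)
subsets-unique zero    = [] ∷ []
subsets-unique (suc m) = Unique.++⁺
  (Unique.map⁺ Vec.∷-injectiveʳ (subsets-unique m))
  (Unique.map⁺ Vec.∷-injectiveʳ (subsets-unique m))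
  λ (A∈ , A∈′) → case-disjoint (∈-map⁻ (outside ∷_) A∈) (∈-map⁻ (inside ∷_) A∈′)
  where
  case-disjoint : ∀ {A : Subset (suc m)} → (∃ λ B → B ∈ subsets m × A ≡ outside ∷ B) →
                  (∃ λ B → B ∈ subsets m × A ≡ inside ∷ B) → _
  case-disjoint (_ , _ , refl) (_ , _ , ())

-- Joining and cutting at the largest letter.

unique-++⁻ : (xs : List A) {ys : List A} → Unique (xs ++ ys) →
             Unique xs × Unique ys × (∀ {x} → x ∈ xs → x ∉ ys)
unique-++⁻ []       ys! = [] , ys! , λ ()
unique-++⁻ (x ∷ xs) (x∉ ∷ xs++ys!)
  with xs! , ys! , xs#ys ← unique-++⁻ xs xs++ys!
  with x∉xs , x∉ys ← All.++⁻ xs x∉ = x∉xs ∷ xs! , ys! , λ where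
    (here refl) x∈ys → All.lookup x∉ys x∈ys refl
    (there y∈xs)     → xs#ys y∈xs

∈-[1⋯suc]⁻ : x ∈ [1⋯ suc m ] → x ≢ suc m → x ∈ [1⋯ m ]
∈-[1⋯suc]⁻ x∈ x≢ with 1≤x , x≤ ← ∈-[1⋯]⁻ x∈ = ∈-[1⋯]⁺ 1≤x (s≤s⁻¹ (≤∧≢⇒< x≤ x≢))

[1⋯]-⊆-suc : [1⋯ m ] ⊆ [1⋯ suc m ]
[1⋯]-⊆-suc x∈ with 1≤x , x≤ ← ∈-[1⋯]⁻ x∈ = ∈-[1⋯]⁺ 1≤x (m≤n⇒m≤1+n x≤)

suc∉[1⋯] : suc m ∉ [1⋯ m ]
suc∉[1⋯] sm∈ = <-irrefl refl (proj₂ (∈-[1⋯]⁻ sm∈))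

arrangement-⊆ : (A : Subset m) → Arrangement (elements A) S a → a ⊆ [1⋯ m ]
arrangement-⊆ A arr = elements-⊆-[1⋯] A ∘ to (letters arr)

letters<suc : a ⊆ [1⋯ m ] → All (_< suc m) a
letters<suc a⊆ = All.tabulate (s≤s ∘ proj₂ ∘ ∈-[1⋯]⁻ ∘ a⊆)

-- A member on each side stands for nonemptiness, which is how it is available for words known
-- through their sets of letters.
Pin-++-∷-++-nonempty : x ∈ a → y ∈ b → All (_< n) a → All (_< n) b → Pin (a ++ n ∷ b) ≡ Pin a ++ n ∷ Pin b
Pin-++-∷-++-nonempty {a = _ ∷ a} {b = _ ∷ b} _ _ = Pin-++-∷-++ a b

-- The witnesses `x` and `y` make both sides nonempty, so `suc m` becomes a pinnacle, which
-- `suc m ∈ S` allows. Every other letter belongs to exactly one side and is a pinnacle of the join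
-- precisely when it is one there.
arrangement-join : (A : Subset m) → x ∈ elements A → y ∈ elements (∁ A) → suc m ∈ S →
                   Arrangement (elements A) S a → Arrangement (elements (∁ A)) S b →
                   Arrangement [1⋯ suc m ] S (a ++ suc m ∷ b)
arrangement-join {m} {S = S} {a} {b} A x∈A y∈∁A sm∈S arrA arrB = record
  { unique    = Unique.++⁺ (unique arrA) (All.tabulate (λ x∈b eq → sm∉b (subst (_∈ b) (sym eq) x∈b)) ∷ unique arrB) disjoint
  ; letters   = mk⇔ letters⇒ letters⇐
  ; pinnacles = mk⇔ pinnacles⇒ pinnacles⇐
  }
  where
  a⊆ = arrangement-⊆ A arrA
  b⊆ = arrangement-⊆ (∁ A) arrB
  sm∉b : suc m ∉ b
  sm∉b = suc∉[1⋯] ∘ b⊆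
  Pin≡ : Pin (a ++ suc m ∷ b) ≡ Pin a ++ suc m ∷ Pin b
  Pin≡ = Pin-++-∷-++-nonempty (from (letters arrA) x∈A) (from (letters arrB) y∈∁A) (letters<suc a⊆) (letters<suc b⊆)
  disjoint : ∀ {z} → ¬ (z ∈ a × z ∈ suc m ∷ b)
  disjoint (z∈a , here refl) = suc∉[1⋯] (a⊆ z∈a)
  disjoint (z∈a , there z∈b) = elements-disjoint A (to (letters arrA) z∈a) (to (letters arrB) z∈b)
  sm∈ : suc m ∈ [1⋯ suc m ]
  sm∈ = ∈-[1⋯]⁺ (s≤s z≤n) ≤-refl
  letters⇒ : a ++ suc m ∷ b ⊆ [1⋯ suc m ]
  letters⇒ z∈ with ∈-++⁻ a z∈
  ... | inj₁ z∈a         = [1⋯]-⊆-suc (a⊆ z∈a)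
  ... | inj₂ (here refl) = sm∈
  ... | inj₂ (there z∈b) = [1⋯]-⊆-suc (b⊆ z∈b)
  letters⇐ : [1⋯ suc m ] ⊆ a ++ suc m ∷ b
  letters⇐ {z} z∈ with z ℕ.≟ suc m
  ... | yes refl = ∈-insert a
  ... | no  z≢   = [ ∈-++⁺ˡ ∘ from (letters arrA) , ∈-++⁺ʳ a ∘ there ∘ from (letters arrB) ]′
                     (elements-cover A (∈-[1⋯suc]⁻ z∈ z≢))
  pinnacles⇒ : ∀ {z} → z ∈ Pin (a ++ suc m ∷ b) → z ∈ [1⋯ suc m ] × z ∈ S
  pinnacles⇒ z∈ = letters⇒ (Pin-⊆ _ z∈) , ∈S (∈-++⁻ (Pin a) (subst (_ ∈_) Pin≡ z∈))
    where
    ∈S : _ → _ ∈ S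
    ∈S (inj₁ z∈a)         = proj₂ (to (pinnacles arrA) z∈a)
    ∈S (inj₂ (here refl)) = sm∈S
    ∈S (inj₂ (there z∈b)) = proj₂ (to (pinnacles arrB) z∈b)
  pinnacles⇐ : ∀ {z} → z ∈ [1⋯ suc m ] × z ∈ S → z ∈ Pin (a ++ suc m ∷ b)
  pinnacles⇐ {z} (z∈ , z∈S) = subst (z ∈_) (sym Pin≡) ∈Pin
    where
    ∈Pin : z ∈ Pin a ++ suc m ∷ Pin b
    ∈Pin with z ℕ.≟ suc m
    ... | yes refl = ∈-insert (Pin a)
    ... | no  z≢ with elements-cover A (∈-[1⋯suc]⁻ z∈ z≢)
    ...   | inj₁ z∈A  = ∈-++⁺ˡ (from (pinnacles arrA) (z∈A , z∈S))
    ...   | inj₂ z∈∁A = ∈-++⁺ʳ (Pin a) (there (from (pinnacles arrB) (z∈∁A , z∈S)))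

-- No letter repeats, so the right part uses precisely the letters of `[1⋯ m ]` missing from the
-- left one. An element of `S` that is a letter of one side must be a pinnacle of that side, since
-- the pinnacles of the other side are letters of the complementary set.
arrangement-split : Arrangement [1⋯ suc m ] S (a ++ suc m ∷ b) → x ∈ a → y ∈ b →
                    let A = subsetOf m a in
                    Arrangement (elements A) S a × Arrangement (elements (∁ A)) S b
arrangement-split {m} {S} {a} {b} arr x∈a y∈b
  with a! , sm∉b ∷ b! , a#smb ← unique-++⁻ a (unique arr) =
  record { unique = a! ; letters = letters-a ; pinnacles = mk⇔ pinnacles-a⇒ pinnacles-a⇐ } ,
  record { unique = b! ; letters = letters-b ; pinnacles = mk⇔ pinnacles-b⇒ pinnacles-b⇐ }
  where
  L = subsetOf m a
  a⊆ : a ⊆ [1⋯ m ]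
  a⊆ z∈a = ∈-[1⋯suc]⁻ (to (letters arr) (∈-++⁺ˡ z∈a)) λ { refl → a#smb z∈a (here refl) }
  b⊆ : b ⊆ [1⋯ m ]
  b⊆ z∈b = ∈-[1⋯suc]⁻ (to (letters arr) (∈-++⁺ʳ a (there z∈b))) (All.lookup sm∉b z∈b ∘ sym)
  a⇒ : a ⊆ elements L
  a⇒ z∈a with i , refl ← ∈-[1⋯]⇒Fin (a⊆ z∈a) = ∈-elements⁺ (∈-subsetOf⁺ z∈a)
  a⇐ : elements L ⊆ a
  a⇐ z∈A with i , i∈A , refl ← ∈-elements⁻ {A = L} z∈A = ∈-subsetOf⁻ i∈A
  letters-a : a ≈ˢ elements L
  letters-a = mk⇔ a⇒ a⇐
  b⇒ : b ⊆ elements (∁ L)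
  b⇒ z∈b with elements-cover L (b⊆ z∈b)
  ... | inj₁ z∈A  = contradiction (there z∈b) (a#smb (a⇐ z∈A))
  ... | inj₂ z∈∁A = z∈∁A
  b⇐ : elements (∁ L) ⊆ b
  b⇐ z∈∁A with ∈-++⁻ a (from (letters arr) ([1⋯]-⊆-suc (elements-⊆-[1⋯] (∁ L) z∈∁A)))
  ... | inj₁ z∈a         = contradiction z∈∁A (elements-disjoint L (a⇒ z∈a))
  ... | inj₂ (here refl) = contradiction (elements-⊆-[1⋯] (∁ L) z∈∁A) suc∉[1⋯]
  ... | inj₂ (there z∈b) = z∈b
  letters-b : b ≈ˢ elements (∁ L)
  letters-b = mk⇔ b⇒ b⇐
  Pin≡ : Pin (a ++ suc m ∷ b) ≡ Pin a ++ suc m ∷ Pin b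
  Pin≡ = Pin-++-∷-++-nonempty x∈a y∈b (letters<suc a⊆) (letters<suc b⊆)
  ∈S : ∀ {z} → z ∈ Pin a ++ suc m ∷ Pin b → z ∈ S
  ∈S z∈ = proj₂ (to (pinnacles arr) (subst (_ ∈_) (sym Pin≡) z∈))
  ∈Pin : ∀ {z} → z ∈ [1⋯ m ] → z ∈ S → z ∈ Pin a ⊎ z ∈ Pin b
  ∈Pin z∈ z∈S
    with ∈-++⁻ (Pin a) (subst (_ ∈_) Pin≡ (from (pinnacles arr) ([1⋯]-⊆-suc z∈ , z∈S)))
  ... | inj₁ z∈Pa         = inj₁ z∈Pa
  ... | inj₂ (here refl)  = contradiction z∈ suc∉[1⋯]
  ... | inj₂ (there z∈Pb) = inj₂ z∈Pb
  pinnacles-a⇒ : ∀ {z} → z ∈ Pin a → z ∈ elements L × z ∈ S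
  pinnacles-a⇒ z∈ = a⇒ (Pin-⊆ a z∈) , ∈S (∈-++⁺ˡ z∈)
  pinnacles-a⇐ : ∀ {z} → z ∈ elements L × z ∈ S → z ∈ Pin a
  pinnacles-a⇐ (z∈A , z∈S) with ∈Pin (elements-⊆-[1⋯] L z∈A) z∈S
  ... | inj₁ z∈Pa = z∈Pa
  ... | inj₂ z∈Pb = contradiction (b⇒ (Pin-⊆ b z∈Pb)) (elements-disjoint L z∈A)
  pinnacles-b⇒ : ∀ {z} → z ∈ Pin b → z ∈ elements (∁ L) × z ∈ S
  pinnacles-b⇒ z∈ = b⇒ (Pin-⊆ b z∈) , ∈S (∈-++⁺ʳ (Pin a) (there z∈))
  pinnacles-b⇐ : ∀ {z} → z ∈ elements (∁ L) × z ∈ S → z ∈ Pin b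
  pinnacles-b⇐ (z∈∁A , z∈S) with ∈Pin (elements-⊆-[1⋯] (∁ L) z∈∁A) z∈S
  ... | inj₁ z∈Pa = contradiction z∈∁A (elements-disjoint L (a⇒ (Pin-⊆ a z∈Pa)))
  ... | inj₂ z∈Pb = z∈Pb

-- Sorting the words by the set of letters left of the largest one.

nonemptyProper? : (A : Subset m) → Dec (Nonempty A × A ⊂ ⊤)
nonemptyProper? A = nonempty? A ×-dec (A ⊂? ⊤)

nonemptyProperSubsets-unique : ∀ m → Unique (nonemptyProperSubsets m)
nonemptyProperSubsets-unique m = Unique.filter⁺ nonemptyProper? (subsets-unique m)

-- Being proper means having a nonempty complement: `A ⊂ ⊤` carries an index outside `A`. In this
-- form the condition is symmetric in the two sides of a cut.
∈-nonemptyProperSubsets⇔ : {A : Subset m} → A ∈ nonemptyProperSubsets m ⇔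
                           ((∃ λ x → x ∈ elements A) × (∃ λ y → y ∈ elements (∁ A)))
∈-nonemptyProperSubsets⇔ {m} {A} = mk⇔ ⇒ ⇐
  where
  ⇒ : A ∈ nonemptyProperSubsets m → (∃ λ x → x ∈ elements A) × (∃ λ y → y ∈ elements (∁ A))
  ⇒ A∈ with (i , i∈) , (_ , j , _ , j∉) ← proj₂ (∈-filter⁻ nonemptyProper? {xs = subsets m} A∈) =
    (_ , ∈-elements⁺ i∈) , (_ , ∈-elements⁺ (x∉p⇒x∈∁p j∉))
  ⇐ : (∃ λ x → x ∈ elements A) × (∃ λ y → y ∈ elements (∁ A)) → A ∈ nonemptyProperSubsets m
  ⇐ ((x , x∈) , (y , y∈))
    with i , i∈ , _ ← ∈-elements⁻ {A = A} x∈ | j , j∈ , _ ← ∈-elements⁻ {A = ∁ A} y∈ =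
    ∈-filter⁺ nonemptyProper? (∈-subsets A) ((i , i∈) , (⊆⊤ , j , ∈⊤ , x∈∁p⇒x∉p j∈))

joins : List ℕ → Subset m → List (List ℕ)
joins {m} S A = map (λ (a , b) → a ++ suc m ∷ b)
                    (cartesianProduct (arrangements (elements A) S) (arrangements (elements (∁ A)) S))

∈-joins⁻ : {A : Subset m} → w ∈ joins S A →
           ∃₂ λ a b → (Arrangement (elements A) S a × Arrangement (elements (∁ A)) S b) × w ≡ a ++ suc m ∷ b
∈-joins⁻ {S = S} {A} w∈
  with (a , b) , ab∈ , refl ← ∈-map⁻ _ w∈
  with a∈ , b∈ ← ∈-cartesianProduct⁻ (arrangements (elements A) S) (arrangements (elements (∁ A)) S) ab∈ =
  a , b , (∈-arrangements⁻ (elements-increasing A) a∈ , ∈-arrangements⁻ (elements-increasing (∁ A)) b∈) , refl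

∈-joins⁺ : {A : Subset m} → Arrangement (elements A) S a → Arrangement (elements (∁ A)) S b →
           a ++ suc m ∷ b ∈ joins S A
∈-joins⁺ {A = A} arrA arrB = ∈-map⁺ _ (∈-cartesianProduct⁺
  (∈-arrangements⁺ (elements-increasing A) arrA)
  (∈-arrangements⁺ (elements-increasing (∁ A)) arrB))

suc∉arrangement : (A : Subset m) → Arrangement (elements A) S a → suc m ∉ a
suc∉arrangement A arr = suc∉[1⋯] ∘ arrangement-⊆ A arr

-- `suc m` does not occur in a left part, so the joined word determines the pair.
joins-unique : (A : Subset m) → Unique (joins S A)
joins-unique {m} {S} A = unique-map-local inj (Unique.cartesianProduct⁺
  (arrangements-unique (elements-increasing A)) (arrangements-unique (elements-increasing (∁ A))))
  where
  LA = arrangements (elements A) S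
  RA = arrangements (elements (∁ A)) S
  inj : ∀ {u v} → u ∈ cartesianProduct LA RA → v ∈ cartesianProduct LA RA →
        proj₁ u ++ suc m ∷ proj₂ u ≡ proj₁ v ++ suc m ∷ proj₂ v → u ≡ v
  inj {a , _} u∈ v∈ eq
    with a∈ , _ ← ∈-cartesianProduct⁻ LA RA u∈ | c∈ , _ ← ∈-cartesianProduct⁻ LA RA v∈
    with refl , refl ← ++-∷-injective a (suc∉arrangement A (∈-arrangements⁻ (elements-increasing A) a∈))
                         (suc∉arrangement A (∈-arrangements⁻ (elements-increasing A) c∈)) eq = refl

-- The word determines its part before `suc m`, and the letters of that part are the elements of the
-- subset.
joins-disjoint : {A B : Subset m} → w ∈ joins S A → w ∈ joins S B → A ≡ B
joins-disjoint {A = A} {B} w∈A w∈B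
  with a , _ , (arrA , _) , refl ← ∈-joins⁻ {A = A} w∈A
  with _ , _ , (arrB , _) , eq ← ∈-joins⁻ {A = B} w∈B
  with refl , _ ← ++-∷-injective a (suc∉arrangement A arrA) (suc∉arrangement B arrB) eq =
  elements-injective (mk⇔ (to (letters arrB) ∘ from (letters arrA)) (to (letters arrA) ∘ from (letters arrB)))

length-joins : (A : Subset m) → length (joins S A) ≡
               p (std (elements A) S) ∣ A ∣ * p (std (elements (∁ A)) S) (m ∸ ∣ A ∣)
length-joins {m} {S} A = begin
  length (joins S A)
    ≡⟨ length-map _ (cartesianProduct LA RA) ⟩
  length (cartesianProduct LA RA)
    ≡⟨ length-cartesianProductWith _,_ LA RA ⟩
  length LA * length RA
    ≡⟨ cong₂ _*_ (length-arrangements (elements A) S) (length-arrangements (elements (∁ A)) S) ⟩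
  p (std (elements A) S) (length (elements A)) * p (std (elements (∁ A)) S) (length (elements (∁ A)))
    ≡⟨ cong₂ (λ k l → p (std (elements A) S) k * p (std (elements (∁ A)) S) l)
         (length-elements A) (trans (length-elements (∁ A)) (∣∁p∣≡n∸∣p∣ A)) ⟩
  p (std (elements A) S) ∣ A ∣ * p (std (elements (∁ A)) S) (m ∸ ∣ A ∣) ∎
  where
  open ≡-Reasoning
  LA = arrangements (elements A) S
  RA = arrangements (elements (∁ A)) S

allJoins : ∀ m → List ℕ → List (List ℕ)
allJoins m S = concatMap (joins S) (nonemptyProperSubsets m)

allJoins-unique : ∀ m S → Unique (allJoins m S)
allJoins-unique m S = unique-concatMap (nonemptyProperSubsets-unique m)
  (λ {A} _ → joins-unique A) (λ {A} {B} → joins-disjoint {A = A} {B})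

∈-allJoins⇔Arrangement : suc m ∈ S → w ∈ allJoins m S ⇔ Arrangement [1⋯ suc m ] S w
∈-allJoins⇔Arrangement {m} {S} {w} sm∈S = mk⇔ ⇒ ⇐
  where
  ⇒ : w ∈ allJoins m S → Arrangement [1⋯ suc m ] S w
  ⇒ w∈ with A , A∈ , w∈A ← find (∈-concatMap⁻ (joins S) {xs = nonemptyProperSubsets m} w∈)
    with a , b , (arrA , arrB) , refl ← ∈-joins⁻ {A = A} w∈A
    with (_ , x∈) , (_ , y∈) ← to ∈-nonemptyProperSubsets⇔ A∈ =
    arrangement-join A x∈ y∈ sm∈S arrA arrB
  ⇐ : Arrangement [1⋯ suc m ] S w → w ∈ allJoins m S
  ⇐ arr
    -- As an element of `S`, the letter `suc m` is a pinnacle of `w`, hence interior; `y` and `z`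
    -- witness that the two parts are nonempty.
    with y , a , z , b , refl ← ∈-Pin⇒interior w (from (pinnacles arr) (∈-[1⋯]⁺ (s≤s z≤n) ≤-refl , sm∈S))
    with arrA , arrB ← arrangement-split {a = y ∷ a} {b = z ∷ b} arr (here refl) (here refl) =
    ∈-concatMap⁺ (joins S) (lose
      (from ∈-nonemptyProperSubsets⇔ ((y , to (letters arrA) (here refl)) , (z , to (letters arrB) (here refl))))
      (∈-joins⁺ arrA arrB))

-- The maximum of an admissible set, and the recurrence.

admissible⇒positive : Admissible S → x ∈ S → 1 ≤ x
admissible⇒positive (k , _ , w , w∈ , S≈) x∈S =
  proj₁ (∈-[1⋯]⁻ (to (proj₂ (∈-permutations⁻ {n = k} w∈)) (Pin-⊆ w (to S≈ x∈S))))

-- `max 0` either selects an entry or returns its default 0; the latter is impossible when the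
-- entries are positive and there is at least one.
max∈ : S ≢ [] → (∀ {x} → x ∈ S → 1 ≤ x) → max 0 S ∈ S
max∈ {[]}    S≢[] _   = contradiction refl S≢[]
max∈ {x ∷ S} _    pos with argmax-sel id 0 (x ∷ S)
... | inj₂ max∈S = max∈S
... | inj₁ max≡0 = contradiction
  (≤-trans (pos (here refl)) (≤-trans (All.lookup (xs≤max 0 (x ∷ S)) (here refl)) (≤-reflexive max≡0))) λ ()

proposition3p3 : (S : List ℕ) (n : ℕ) → S ≢ [] → Admissible S → max 0 S ≡ n →
    p S n ≡ sum (map (λ A → p (std (elements A) S) ∣ A ∣ * p (std (elements (∁ A)) S) (n ∸ 1 ∸ ∣ A ∣))
    (nonemptyProperSubsets (n ∸ 1)))
proposition3p3 S n S≢[] adm refl with max 0 S in max≡n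
-- The maximum is an element of `S` and so positive. Once it has the form `suc m`, the `n ∸ 1` of
-- the statement computes to `m`.
... | zero  = contradiction (admissible⇒positive adm (max∈ S≢[] (admissible⇒positive adm))) λ 1≤max → <⇒≢ 1≤max (sym max≡n)
... | suc m = begin
  p S (suc m)
    -- Both lists are free of duplicates and have the words satisfying `Arrangement [1⋯ suc m ] S`
    -- as members, so they are equally long.
    ≡⟨ unique-set⇒length≡ (permutationsWithPin-unique S (suc m)) (allJoins-unique m S)
         (from (∈-allJoins⇔Arrangement sm∈S) ∘ to (∈-permutationsWithPin⇔Arrangement S⊆))
         (from (∈-permutationsWithPin⇔Arrangement S⊆) ∘ to (∈-allJoins⇔Arrangement sm∈S)) ⟩
  length (allJoins m S)
    ≡⟨ length-concatMap (joins S) (nonemptyProperSubsets m) ⟩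
  sum (map (length ∘ joins S) (nonemptyProperSubsets m))
    ≡⟨ cong sum (map-cong length-joins (nonemptyProperSubsets m)) ⟩
  sum (map (λ A → p (std (elements A) S) ∣ A ∣ * p (std (elements (∁ A)) S) (m ∸ ∣ A ∣)) (nonemptyProperSubsets m)) ∎
  where
  open ≡-Reasoning
  sm∈S : suc m ∈ S
  sm∈S = subst (_∈ S) max≡n (max∈ S≢[] (admissible⇒positive adm))
  S⊆ : S ⊆ [1⋯ suc m ]
  S⊆ x∈S = ∈-[1⋯]⁺ (admissible⇒positive adm x∈S) (subst (_ ≤_) max≡n (All.lookup (xs≤max 0 S) x∈S))
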